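{- For integers $\ell\geq b\geq0$ we have the identity $$\frac{\partial\hat R^{(b)}}{\partial\hat x_\ell}=I(b,\ell;\hat R^{(b)})\,\frac{\partial\hat R^{(b)}}{\partial\hat x_b}.$$
   Context: Define the formal power series in $r$ $$I(b,\ell;r)=\sum_{p=0}^\infty\frac{r^p}{(p!)^2}\prod_{m=0}^{p-1}(\ell^2-(b-m)^2),\qquad J(b;r)=\sum_{p=1}^\infty\frac{(-1)^{p+1}r^p}{p!(p-1)!}\prod_{m=0}^{p-2}(b-m)(b-m-1).$$ $\hat R^{(b)}(\hat x_b,\hat x_{b+1},\ldots)$ is the unique formal power series with zero constant term such that $J(b;\hat R^{(b)})-\sum_{\ell=b}^\infty I(b,\ell;\hat R^{(b)})\,\hat x_\ell=0$. -}

module Defs where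

open import Data.Nat.Base as ℕ using (ℕ; zero; suc; _∸_; _≤_; _<_; z≤n; s≤s; _!)
import Data.Nat.Properties as ℕₚ
open import Data.Integer.Base as ℤ using (ℤ; +_; 1ℤ; -1ℤ)
import Data.Integer.Properties as ℤₚ
open import Data.Rational.Base as ℚ using (ℚ; 0ℚ; 1ℚ; _/_)
import Data.Rational.Properties as ℚₚ
open import Data.Fin.Base using (Fin; toℕ; fromℕ; inject₁)
open import Data.Fin.Properties using (toℕ-fromℕ; toℕ-inject₁; toℕ≤pred[n])
open import Data.List.Base using (List; []; _∷_; _++_; [_]; length)
open import Data.List.Properties using (length-++)
open import Data.Nat.ListAction using () renaming (sum to degree)
open import Data.Nat.ListAction.Properties using (sum-++)
open import Function.Base using (_∘_)
open import Relation.Binary.PropositionalEquality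
  using (_≡_; refl; sym; trans; cong; cong₂; subst; module ≡-Reasoning)

open import Algebra.Properties.CommutativeMonoid.Sum ℚₚ.+-0-commutativeMonoid public
  using (sum-syntax; sum⁺-syntax)
open import Algebra.Properties.CommutativeMonoid.Sum ℚₚ.+-0-commutativeMonoid
  using (sum; sum-cong-≗; sum-replicate-zero; sum-init-last)
open import Algebra.Properties.CommutativeMonoid.Sum ℤₚ.*-1-commutativeMonoid
  using () renaming (sum to product)

infixl 10 ∏-syntax
∏-syntax : ∀ n → (Fin n → ℤ) → ℤ
∏-syntax _ = product
syntax ∏-syntax n (λ i → x) = ∏[ i < n ] x

-- The list a₀ ∷ a₁ ∷ … ∷ aₙ₋₁ ∷ [] stands for the monomial
-- X₀^a₀ X₁^a₁ ⋯ Xₙ₋₁^aₙ₋₁ in the infinitely many variables X₀, X₁, … ;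
-- trailing zeros are insignificant.
Monomial : Set
Monomial = List ℕ

Coefficients : Set
Coefficients = Monomial → ℚ

Compatible : Coefficients → Set
Compatible f = ∀ α → f (α ++ [ 0 ]) ≡ f α

-- ℚ⟦X₀, X₁, …⟧
record PowerSeries : Set where
  constructor mkPS
  field
    coeff      : Coefficients
    compatible : Compatible coeff

open PowerSeries public

infix 4 _≈_
_≈_ : PowerSeries → PowerSeries → Set
f ≈ g = ∀ α → coeff f α ≡ coeff g α

-- Coefficient of X₀^i in f, as a series in X₁, X₂, … (renumbered from 0).
infixl 9 _↾_
_↾_ : Coefficients → ℕ → Coefficients
(f ↾ i) α = f (i ∷ α)

-- Cauchy product: the sum of f β · g γ over all β γ = α, enumerated one
-- variable at a time.
mulᶜ : Coefficients → Coefficients → Coefficients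
mulᶜ f g []      = f [] ℚ.* g []
mulᶜ f g (a ∷ α) = ∑[ i ≤ a ] mulᶜ (f ↾ toℕ i) (g ↾ (a ∸ toℕ i)) α

oneᶜ : Coefficients
oneᶜ []          = 1ℚ
oneᶜ (zero ∷ α)  = oneᶜ α
oneᶜ (suc _ ∷ α) = 0ℚ

varᶜ : ℕ → Coefficients
varᶜ k       []                = 0ℚ
varᶜ zero    (zero ∷ α)        = 0ℚ
varᶜ zero    (suc zero ∷ α)    = oneᶜ α
varᶜ zero    (suc (suc _) ∷ α) = 0ℚ
varᶜ (suc k) (zero ∷ α)        = varᶜ k α
varᶜ (suc k) (suc _ ∷ α)       = 0ℚ

exponent : ℕ → Monomial → ℕ
exponent k       []      = 0
exponent zero    (a ∷ α) = a
exponent (suc k) (a ∷ α) = exponent k α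

-- Multiplication of a monomial by X k.
raise : ℕ → Monomial → Monomial
raise zero    []      = 1 ∷ []
raise zero    (a ∷ α) = suc a ∷ α
raise (suc k) []      = 0 ∷ raise k []
raise (suc k) (a ∷ α) = a ∷ raise k α

mulᶜ-compatible : ∀ {f g} → Compatible f → Compatible g → Compatible (mulᶜ f g)
mulᶜ-compatible cf cg []      = trans (ℚₚ.+-identityʳ _) (cong₂ ℚ._*_ (cf []) (cg []))
mulᶜ-compatible cf cg (a ∷ α) = sum-cong-≗ {suc a} λ i →
  mulᶜ-compatible (cf ∘ (toℕ i ∷_)) (cg ∘ (a ∸ toℕ i ∷_)) α

oneᶜ-compatible : Compatible oneᶜ
oneᶜ-compatible []          = refl
oneᶜ-compatible (zero ∷ α)  = oneᶜ-compatible α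
oneᶜ-compatible (suc _ ∷ α) = refl

varᶜ-compatible : ∀ k → Compatible (varᶜ k)
varᶜ-compatible zero    []                = refl
varᶜ-compatible (suc k) []                = refl
varᶜ-compatible zero    (zero ∷ α)        = refl
varᶜ-compatible zero    (suc zero ∷ α)    = oneᶜ-compatible α
varᶜ-compatible zero    (suc (suc _) ∷ α) = refl
varᶜ-compatible (suc k) (zero ∷ α)        = varᶜ-compatible k α
varᶜ-compatible (suc k) (suc _ ∷ α)       = refl

exponent-compatible : ∀ k α → exponent k (α ++ [ 0 ]) ≡ exponent k α
exponent-compatible zero    []      = refl
exponent-compatible (suc k) []      = refl
exponent-compatible zero    (a ∷ α) = refl
exponent-compatible (suc k) (a ∷ α) = exponent-compatible k α

raise-compatible : ∀ k {f} → Compatible f → Compatible (f ∘ raise k)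
raise-compatible zero    cf []      = refl
raise-compatible (suc k) cf []      = refl
raise-compatible zero    cf (a ∷ α) = cf (suc a ∷ α)
raise-compatible (suc k) cf (a ∷ α) = raise-compatible k (cf ∘ (a ∷_)) α

degree-compatible : ∀ α → degree (α ++ [ 0 ]) ≡ degree α
degree-compatible α = trans (sum-++ α [ 0 ]) (ℕₚ.+-identityʳ _)

sum-zero : ∀ n {t : Fin n → ℚ} → (∀ i → t i ≡ 0ℚ) → sum t ≡ 0ℚ
sum-zero n t≡0 = trans (sum-cong-≗ t≡0) (sum-replicate-zero n)

mulᶜ-zeroʳ : ∀ f {g} → (∀ α → g α ≡ 0ℚ) → ∀ α → mulᶜ f g α ≡ 0ℚ
mulᶜ-zeroʳ f g≡0 []      = trans (cong (f [] ℚ.*_) (g≡0 [])) (ℚₚ.*-zeroʳ (f []))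
mulᶜ-zeroʳ f g≡0 (a ∷ α) = sum-zero (suc a) λ i →
  mulᶜ-zeroʳ (f ↾ toℕ i) (λ β → g≡0 (a ∸ toℕ i ∷ β)) α

mulᶜ-varᶜ-zero : ∀ f k α → length α ≤ k → mulᶜ f (varᶜ k) α ≡ 0ℚ
mulᶜ-varᶜ-zero f k       []      _         = ℚₚ.*-zeroʳ (f [])
mulᶜ-varᶜ-zero f (suc k) (a ∷ α) (s≤s α≤k) = sum-zero (suc a) λ i → slice (f ↾ toℕ i) (a ∸ toℕ i)
  where
  slice : ∀ g j → mulᶜ g (varᶜ (suc k) ↾ j) α ≡ 0ℚ
  slice g zero    = mulᶜ-varᶜ-zero g k α α≤k
  slice g (suc j) = mulᶜ-zeroʳ g (λ _ → refl) α

0# : PowerSeries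
0# = mkPS (λ _ → 0ℚ) (λ _ → refl)

1# : PowerSeries
1# = mkPS oneᶜ oneᶜ-compatible

X : ℕ → PowerSeries
X k = mkPS (varᶜ k) (varᶜ-compatible k)

infixl 6 _-_
infixl 7 _*_
infixr 8 _^_

_-_ : PowerSeries → PowerSeries → PowerSeries
f - g = mkPS (λ α → coeff f α ℚ.- coeff g α) (λ α → cong₂ ℚ._-_ (compatible f α) (compatible g α))

_*_ : PowerSeries → PowerSeries → PowerSeries
f * g = mkPS (mulᶜ (coeff f) (coeff g)) (mulᶜ-compatible (compatible f) (compatible g))

_^_ : PowerSeries → ℕ → PowerSeries
f ^ zero  = 1#
f ^ suc n = f * f ^ n

∂ : ℕ → PowerSeries → PowerSeries
∂ k f = mkPS (λ α → (+ suc (exponent k α) / 1) ℚ.* coeff f (raise k α))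
             (λ α → cong₂ (λ e c → (+ suc e / 1) ℚ.* c)
                          (exponent-compatible k α)
                          (raise-compatible k (compatible f) α))

constantTerm : PowerSeries → ℚ
constantTerm f = coeff f []

-- The infinite sum Σ_{k ≥ 0} F k · X k.  By mulᶜ-varᶜ-zero only the terms with
-- k < length α contribute to the coefficient at α.
∑X : (ℕ → PowerSeries) → PowerSeries
∑X F = mkPS (λ α → ∑[ k < length α ] term α (toℕ k)) compat
  where
  term : Monomial → ℕ → ℚ
  term α k = coeff (F k * X k) α

  compat : Compatible (λ α → ∑[ k < length α ] term α (toℕ k))
  compat α = begin
    sum {length (α ++ [ 0 ])} (λ k → term (α ++ [ 0 ]) (toℕ k))
      ≡⟨ sum-cong-≗ {length (α ++ [ 0 ])} (λ k → compatible (F (toℕ k) * X (toℕ k)) α) ⟩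
    sum {length (α ++ [ 0 ])} (term α ∘ toℕ)
      ≡⟨ cong (λ n → sum {n} (term α ∘ toℕ)) (trans (length-++ α) (ℕₚ.+-comm (length α) 1)) ⟩
    sum {suc (length α)} (term α ∘ toℕ)
      ≡⟨ sum-init-last {length α} (term α ∘ toℕ) ⟩
    sum {length α} (term α ∘ toℕ ∘ inject₁) ℚ.+ term α (toℕ (fromℕ (length α)))
      ≡⟨ cong₂ ℚ._+_ (sum-cong-≗ {length α} (cong (term α) ∘ toℕ-inject₁))
                     (trans (cong (term α) (toℕ-fromℕ (length α)))
                            (mulᶜ-varᶜ-zero (coeff (F (length α))) (length α) α ℕₚ.≤-refl)) ⟩
    sum {length α} (term α ∘ toℕ) ℚ.+ 0ℚ
      ≡⟨ ℚₚ.+-identityʳ _ ⟩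
    sum {length α} (term α ∘ toℕ) ∎
    where open ≡-Reasoning

-- ℚ⟦r⟧
PowerSeries₁ : Set
PowerSeries₁ = ℕ → ℚ

-- The substitution c(R) = Σ_{p ≥ 0} c p · R ^ p, meaningful when R has zero
-- constant term: by ^-vanishes only the terms with p ≤ degree α then
-- contribute to the coefficient at α.
infixl 9 _⟪_⟫
_⟪_⟫ : PowerSeries₁ → PowerSeries → PowerSeries
c ⟪ R ⟫ = mkPS (λ α → ∑[ p ≤ degree α ] term α (toℕ p)) compat
  where
  term : Monomial → ℕ → ℚ
  term α p = c p ℚ.* coeff (R ^ p) α

  compat : Compatible (λ α → ∑[ p ≤ degree α ] term α (toℕ p))
  compat α = trans
    (sum-cong-≗ {suc (degree (α ++ [ 0 ]))}
                (λ p → cong (c (toℕ p) ℚ.*_) (compatible (R ^ toℕ p) α)))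
    (cong (λ n → sum {suc n} (term α ∘ toℕ)) (degree-compatible α))

VanishesBelow : ℕ → Coefficients → Set
VanishesBelow m f = ∀ α → degree α < m → f α ≡ 0ℚ

↾-vanishes : ∀ {m f} i → VanishesBelow m f → VanishesBelow (m ∸ i) (f ↾ i)
↾-vanishes {m} i vf α d<m∸i = vf (i ∷ α) (ℕₚ.≤-trans
  (ℕₚ.≤-reflexive (sym (ℕₚ.+-suc i (degree α))))
  (ℕₚ.≤-trans (ℕₚ.+-monoʳ-≤ i d<m∸i)
    (ℕₚ.≤-reflexive (ℕₚ.m+[n∸m]≡n (ℕₚ.<⇒≤ (ℕₚ.m∸n≢0⇒n<m {m} {i} (λ e → ℕₚ.n≮0 (subst (degree α <_) e d<m∸i))))))))

split-bound : ∀ {m n a d i} → i ≤ a → a ℕ.+ d < m ℕ.+ n → d < (m ∸ i) ℕ.+ (n ∸ (a ∸ i))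
split-bound {m} {n} {a} {d} {i} i≤a a+d<m+n = ℕₚ.+-cancelˡ-≤ a (suc d) _ (begin
  a ℕ.+ suc d                                     ≡⟨ ℕₚ.+-suc a d ⟩
  suc (a ℕ.+ d)                                   ≤⟨ a+d<m+n ⟩
  m ℕ.+ n                                         ≤⟨ ℕₚ.+-mono-≤ (ℕₚ.m≤n+m∸n m i) (ℕₚ.m≤n+m∸n n j) ⟩
  (i ℕ.+ (m ∸ i)) ℕ.+ (j ℕ.+ (n ∸ j))             ≡⟨ interchange i (m ∸ i) j (n ∸ j) ⟩
  (i ℕ.+ j) ℕ.+ ((m ∸ i) ℕ.+ (n ∸ j))             ≡⟨ cong (ℕ._+ ((m ∸ i) ℕ.+ (n ∸ j))) (ℕₚ.m+[n∸m]≡n i≤a) ⟩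
  a ℕ.+ ((m ∸ i) ℕ.+ (n ∸ j))                     ∎)
  where
  open ℕₚ.≤-Reasoning
  open import Algebra.Properties.CommutativeSemigroup ℕₚ.+-commutativeSemigroup using (interchange)
  j = a ∸ i

mulᶜ-vanishes : ∀ {m n f g} → VanishesBelow m f → VanishesBelow n g → VanishesBelow (m ℕ.+ n) (mulᶜ f g)
mulᶜ-vanishes {zero}  {f = f}         vf vg []      0<n = trans (cong (f [] ℚ.*_) (vg [] 0<n)) (ℚₚ.*-zeroʳ (f []))
mulᶜ-vanishes {suc m} {f = f} {g = g} vf vg []      _   = trans (cong (ℚ._* g []) (vf [] (s≤s z≤n))) (ℚₚ.*-zeroˡ (g []))
mulᶜ-vanishes {m} {n} {f} {g} vf vg (a ∷ α) d<m+n = sum-zero (suc a) λ i →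
  mulᶜ-vanishes {m ∸ toℕ i} {n ∸ (a ∸ toℕ i)} {f ↾ toℕ i} {g ↾ (a ∸ toℕ i)}
    (↾-vanishes {m} {f} (toℕ i) vf) (↾-vanishes {n} {g} (a ∸ toℕ i) vg)
    α (split-bound {m} {n} {a} (toℕ≤pred[n] i) d<m+n)

positive-vanishes : ∀ R → constantTerm R ≡ 0ℚ → VanishesBelow 1 (coeff R)
positive-vanishes R R₀≡0 []          _ = R₀≡0
positive-vanishes R R₀≡0 (zero ∷ α)  d<1 = positive-vanishes (mkPS (coeff R ↾ 0) (compatible R ∘ (0 ∷_))) (trans (compatible R []) R₀≡0) α d<1
positive-vanishes R R₀≡0 (suc _ ∷ α) (s≤s ())

^-vanishes : ∀ R → constantTerm R ≡ 0ℚ → ∀ p α → degree α < p → coeff (R ^ p) α ≡ 0ℚ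
^-vanishes R R₀≡0 (suc p) = mulᶜ-vanishes {1} {p} {coeff R} {coeff (R ^ p)}
  (positive-vanishes R R₀≡0) (^-vanishes R R₀≡0 p)

I : ℕ → ℕ → PowerSeries₁
I b ℓ p = (∏[ m < p ] ((+ ℓ) ℤ.^ 2 ℤ.- (+ b ℤ.- + toℕ m) ℤ.^ 2)) / ((p !) ℕ.^ 2)
  where instance _ = ℕₚ.m^n≢0 (p !) 2 {{p ℕₚ.!≢0}}

-- The coefficient at r^p, p = suc q, involves (p ∸ 1)! = q ! and the product
-- over 0 ≤ m ≤ p - 2, i.e. m < q.
J : ℕ → PowerSeries₁
J b zero      = 0ℚ
J b p@(suc q) =
  (-1ℤ ℤ.^ (p ℕ.+ 1) ℤ.* (∏[ m < q ] ((+ b ℤ.- + toℕ m) ℤ.* (+ b ℤ.- + toℕ m ℤ.- 1ℤ)))) / (p ! ℕ.* q !)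
  where instance _ = p ℕₚ.!* q !≢0

-- The variables x̂_b, x̂_{b+1}, … are X 0, X 1, … ; thus x̂_ℓ is X (ℓ ∸ b).
∂/∂x̂ : (b ℓ : ℕ) → PowerSeries → PowerSeries
∂/∂x̂ b ℓ = ∂ (ℓ ∸ b)

-- The sum Σ_{ℓ ≥ b} F ℓ · x̂_ℓ.
∑x̂ : ℕ → (ℕ → PowerSeries) → PowerSeries
∑x̂ b F = ∑X (λ k → F (b ℕ.+ k))

-- The defining property of R̂⁽ᵇ⁾.
record IsR̂ (b : ℕ) (R : PowerSeries) : Set where
  field
    zeroConstantTerm : constantTerm R ≡ 0ℚ
    equation         : J b ⟪ R ⟫ - ∑x̂ b (λ ℓ → I b ℓ ⟪ R ⟫) ≈ 0#

{-# OPTIONS --safe #-}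
-- Differentiating J(R̂) = Σ_m I(b,m;R̂) x̂_m with respect to x̂_ℓ gives
-- A · ∂R̂/∂x̂_ℓ = B · ∂R̂/∂x̂_ℓ + I(b,ℓ;R̂) with A = J′(R̂), B = Σ_m I′(b,m;R̂) x̂_m.
-- As I(b,b;r) = 1, the case ℓ = b says that A − B is the inverse of ∂R̂/∂x̂_b.

module Submission where

open import Defs
open import Data.Nat.Base using (ℕ; _≤_)

open import Algebra.Bundles using (CommutativeRing; CommutativeSemiring)
import Algebra.Construct.Pointwise as Pointwise
import Algebra.Properties.CommutativeMonoid.Sum
import Algebra.Properties.Semiring.Sum
import Algebra.Properties.CommutativeSemigroup
import Algebra.Properties.Group
open import Algebra.Structures.Biased using (isCommutativeSemiringˡ)
open import Data.Fin.Base using (Fin; zero; suc; toℕ)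
open import Data.Fin.Properties using (toℕ≤pred[n])
import Data.Integer.Base as ℤ
import Data.Integer.Properties as ℤₚ
open import Data.List.Base using ([]; _∷_; length)
open import Data.List.Relation.Binary.Pointwise
  using (Pointwise-length) renaming (Pointwise to ListPointwise; [] to []ᵖ; _∷_ to _∷ᵖ_)
open import Data.Nat.Base using (zero; suc; _<_; _∸_; z≤n; s≤s)
import Data.Nat.Base as ℕ
open import Data.Nat.ListAction using () renaming (sum to degree)
import Data.Nat.Properties as ℕₚ
open import Data.Rational.Base using (ℚ; 0ℚ; _/_; _+_) renaming (_*_ to _·_)
import Data.Rational.Properties as ℚₚ
import Data.Rational.Unnormalised.Base as ℚᵘ
import Data.Rational.Unnormalised.Properties as ℚᵘₚ
open import Data.Product.Base using (_,_)
open import Function.Base using (_∘_; flip)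
open import Relation.Binary.PropositionalEquality
  using (_≡_; _≢_; _≗_; refl; sym; trans; cong; cong₂; subst; subst₂; isEquivalence; module ≡-Reasoning)
open import Relation.Nullary using (contradiction)

open Algebra.Properties.CommutativeMonoid.Sum ℚₚ.+-0-commutativeMonoid
  using (sum; sum-cong-≗; ∑-distrib-+)
open Algebra.Properties.Semiring.Sum (CommutativeRing.semiring ℚₚ.+-*-commutativeRing)
  using (*-distribˡ-sum)
open Algebra.Properties.Group ℚₚ.+-0-group using (x∙y⁻¹≈ε⇒x≈y; ∙-cancelˡ)
private
  module ℚ* = Algebra.Properties.CommutativeSemigroup
    (CommutativeRing.*-commutativeSemigroup ℚₚ.+-*-commutativeRing)

open ≡-Reasoning

ι : ℕ → ℚ
ι n = ℤ.+ n / 1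

ι-+ : ∀ m n → ι (m ℕ.+ n) ≡ ι m + ι n
ι-+ m n = ℚₚ.toℚᵘ-injective
  (ℚᵘₚ.≃-trans (ℚₚ.toℚᵘ-fromℚᵘ (ℚᵘ.mkℚᵘ (ℤ.+ (m ℕ.+ n)) 0))
  (ℚᵘₚ.≃-trans (ℚᵘ.*≡* (cong (ℤ._* ℤ.+ 1) (cong₂ ℤ._+_ (sym (ℤₚ.*-identityʳ (ℤ.+ m))) (sym (ℤₚ.*-identityʳ (ℤ.+ n))))))
  (ℚᵘₚ.≃-trans (ℚᵘₚ.+-cong (ℚᵘₚ.≃-sym (ℚₚ.toℚᵘ-fromℚᵘ (ℚᵘ.mkℚᵘ (ℤ.+ m) 0)))
                           (ℚᵘₚ.≃-sym (ℚₚ.toℚᵘ-fromℚᵘ (ℚᵘ.mkℚᵘ (ℤ.+ n) 0))))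
  (ℚᵘₚ.≃-sym (ℚₚ.toℚᵘ-homo-+ (ι m) (ι n))))))

sum-truncate : ∀ {m n} (t : ℕ → ℚ) → m ≤ n → (∀ i → m ≤ i → t i ≡ 0ℚ) →
               sum {n} (t ∘ toℕ) ≡ sum {m} (t ∘ toℕ)
sum-truncate {n = n} t z≤n       t≡0 = sum-zero n (λ i → t≡0 (toℕ i) z≤n)
sum-truncate         t (s≤s m≤n) t≡0 =
  cong (t 0 +_) (sum-truncate (t ∘ suc) m≤n (λ i m≤i → t≡0 (suc i) (s≤s m≤i)))

sum-single : ∀ {n} j (t : ℕ → ℚ) → j < n → (∀ i → i ≢ j → t i ≡ 0ℚ) → sum {n} (t ∘ toℕ) ≡ t j
sum-single {suc n} zero    t _         t≡0 =
  trans (cong (t 0 +_) (sum-zero n (λ i → t≡0 (suc (toℕ i)) (λ ())))) (ℚₚ.+-identityʳ (t 0))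
sum-single {suc n} (suc j) t (s≤s j<n) t≡0 =
  trans (cong₂ _+_ (t≡0 0 (λ ()))
                   (sum-single j (t ∘ suc) j<n (λ i i≢j → t≡0 (suc i) (i≢j ∘ ℕₚ.suc-injective))))
        (ℚₚ.+-identityˡ (t (suc j)))

conv : ℕ → (ℕ → ℕ → ℚ) → ℚ
conv a t = ∑[ i ≤ a ] t (toℕ i) (a ∸ toℕ i)

conv-cong : ∀ a {t u : ℕ → ℕ → ℚ} → (∀ i j → t i j ≡ u i j) → conv a t ≡ conv a u
conv-cong a t≡u = sum-cong-≗ {suc a} (λ i → t≡u (toℕ i) (a ∸ toℕ i))

conv-+ : ∀ a (t u : ℕ → ℕ → ℚ) → conv a (λ i j → t i j + u i j) ≡ conv a t + conv a u
conv-+ a t u = ∑-distrib-+ {suc a} (λ i → t (toℕ i) (a ∸ toℕ i)) (λ i → u (toℕ i) (a ∸ toℕ i))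

conv-· : ∀ a c (t : ℕ → ℕ → ℚ) → c · conv a t ≡ conv a (λ i j → c · t i j)
conv-· a c t = *-distribˡ-sum {suc a} c (λ i → t (toℕ i) (a ∸ toℕ i))

conv-last : ∀ a (t : ℕ → ℕ → ℚ) → conv (suc a) t ≡ conv a (λ i j → t i (suc j)) + t (suc a) 0
conv-last zero    t =
  cong₂ _+_ (sym (ℚₚ.+-identityʳ (t 0 1))) (ℚₚ.+-identityʳ (t 1 0))
conv-last (suc a) t =
  trans (cong (t 0 (suc (suc a)) +_) (conv-last a (t ∘ suc))) (sym (ℚₚ.+-assoc (t 0 (suc (suc a))) _ _))

conv-comm : ∀ a (t : ℕ → ℕ → ℚ) → conv a t ≡ conv a (flip t)
conv-comm zero    t = refl
conv-comm (suc a) t = begin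
  t 0 (suc a) + conv a (t ∘ suc)        ≡⟨ cong (t 0 (suc a) +_) (conv-comm a (t ∘ suc)) ⟩
  t 0 (suc a) + conv a (flip (t ∘ suc)) ≡⟨ ℚₚ.+-comm (t 0 (suc a)) _ ⟩
  conv a (flip (t ∘ suc)) + t 0 (suc a) ≡⟨ conv-last a (flip t) ⟨
  conv (suc a) (flip t)                 ∎

conv-assoc : ∀ a (t : ℕ → ℕ → ℕ → ℚ) →
             conv a (λ i k → conv i (λ j l → t j l k)) ≡ conv a (λ j m → conv m (λ l k → t j l k))
conv-assoc zero    t = refl
conv-assoc (suc a) t = begin
  (t 0 0 (suc a) + 0ℚ) + conv a (λ i k → t 0 (suc i) k + conv i (λ j l → t (suc j) l k))
    ≡⟨ cong₂ _+_ (ℚₚ.+-identityʳ (t 0 0 (suc a))) (conv-+ a (t 0 ∘ suc) (λ i k → conv i (λ j l → t (suc j) l k))) ⟩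
  t 0 0 (suc a) + (conv a (t 0 ∘ suc) + conv a (λ i k → conv i (λ j l → t (suc j) l k)))
    ≡⟨ ℚₚ.+-assoc (t 0 0 (suc a)) _ _ ⟨
  conv (suc a) (t 0) + conv a (λ i k → conv i (λ j l → t (suc j) l k))
    ≡⟨ cong (conv (suc a) (t 0) +_) (conv-assoc a (t ∘ suc)) ⟩
  conv (suc a) (λ j m → conv m (t j)) ∎

-- The Leibniz rule in one variable: the weight suc a is split as i + j.
conv-leibniz : ∀ a (t : ℕ → ℕ → ℚ) →
               ι (suc a) · conv (suc a) t ≡
               conv a (λ i j → ι (suc i) · t (suc i) j) + conv a (λ i j → ι (suc j) · t i (suc j))
conv-leibniz a t = begin
  ι (suc a) · conv (suc a) t
    ≡⟨ conv-· (suc a) (ι (suc a)) t ⟩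
  conv (suc a) (λ i j → ι (suc a) · t i j)
    ≡⟨ sum-cong-≗ {suc (suc a)} (λ i → split (toℕ i) (toℕ≤pred[n] i)) ⟩
  conv (suc a) (λ i j → u i j + v i j)
    ≡⟨ conv-+ (suc a) u v ⟩
  (0ℚ · t 0 (suc a) + conv a (u ∘ suc)) + conv (suc a) v
    ≡⟨ cong₂ _+_
         (trans (cong (_+ conv a (u ∘ suc)) (ℚₚ.*-zeroˡ (t 0 (suc a)))) (ℚₚ.+-identityˡ (conv a (u ∘ suc))))
         (trans (conv-last a v)
           (trans (cong (conv a v′ +_) (ℚₚ.*-zeroˡ (t (suc a) 0))) (ℚₚ.+-identityʳ (conv a v′)))) ⟩
  conv a (u ∘ suc) + conv a v′ ∎
  where
  u v v′ : ℕ → ℕ → ℚ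
  u  i j = ι i · t i j
  v  i j = ι j · t i j
  v′ i j = v i (suc j)

  split : ∀ i → i ≤ suc a →
          ι (suc a) · t i (suc a ∸ i) ≡ ι i · t i (suc a ∸ i) + ι (suc a ∸ i) · t i (suc a ∸ i)
  split i i≤a = trans
    (cong (_· t i (suc a ∸ i)) (trans (cong ι (sym (ℕₚ.m+[n∸m]≡n i≤a))) (ι-+ i (suc a ∸ i))))
    (ℚₚ.*-distribʳ-+ (t i (suc a ∸ i)) (ι i) (ι (suc a ∸ i)))

infixl 6 _⊕_
_⊕_ : Coefficients → Coefficients → Coefficients
(f ⊕ g) α = f α + g α

infixr 7 _⊙_
_⊙_ : ℚ → Coefficients → Coefficients
(c ⊙ f) α = c · f α

0ᶜ : Coefficients
0ᶜ _ = 0ℚ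

mulᶜ-comm : ∀ f g → mulᶜ f g ≗ mulᶜ g f
mulᶜ-comm f g []      = ℚₚ.*-comm (f []) (g [])
mulᶜ-comm f g (a ∷ α) = trans
  (conv-comm a (λ i j → mulᶜ (f ↾ i) (g ↾ j) α))
  (conv-cong a (λ i j → mulᶜ-comm (f ↾ j) (g ↾ i) α))

mulᶜ-congˡ-≤ : ∀ {f f′} g α → (∀ {β} → ListPointwise _≤_ β α → f β ≡ f′ β) →
               mulᶜ f g α ≡ mulᶜ f′ g α
mulᶜ-congˡ-≤ g []      f≡f′ = cong (_· g []) (f≡f′ []ᵖ)
mulᶜ-congˡ-≤ g (a ∷ α) f≡f′ = sum-cong-≗ {suc a} (λ i →
  mulᶜ-congˡ-≤ (g ↾ (a ∸ toℕ i)) α (λ β≤α → f≡f′ (toℕ≤pred[n] i ∷ᵖ β≤α)))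

mulᶜ-congˡ : ∀ {f f′} g → f ≗ f′ → mulᶜ f g ≗ mulᶜ f′ g
mulᶜ-congˡ g f≗f′ α = mulᶜ-congˡ-≤ g α (λ {β} _ → f≗f′ β)

mulᶜ-congʳ : ∀ f {g g′} → g ≗ g′ → mulᶜ f g ≗ mulᶜ f g′
mulᶜ-congʳ f {g} {g′} g≗g′ α =
  trans (mulᶜ-comm f g α) (trans (mulᶜ-congˡ f g≗g′ α) (mulᶜ-comm g′ f α))

mulᶜ-distribʳ : ∀ h f g → mulᶜ (f ⊕ g) h ≗ mulᶜ f h ⊕ mulᶜ g h
mulᶜ-distribʳ h f g []      = ℚₚ.*-distribʳ-+ (h []) (f []) (g [])
mulᶜ-distribʳ h f g (a ∷ α) = trans
  (conv-cong a (λ i j → mulᶜ-distribʳ (h ↾ j) (f ↾ i) (g ↾ i) α))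
  (conv-+ a (λ i j → mulᶜ (f ↾ i) (h ↾ j) α) (λ i j → mulᶜ (g ↾ i) (h ↾ j) α))

mulᶜ-scaleˡ : ∀ c f g → mulᶜ (c ⊙ f) g ≗ c ⊙ mulᶜ f g
mulᶜ-scaleˡ c f g []      = ℚₚ.*-assoc c (f []) (g [])
mulᶜ-scaleˡ c f g (a ∷ α) = trans
  (conv-cong a (λ i j → mulᶜ-scaleˡ c (f ↾ i) (g ↾ j) α))
  (sym (conv-· a c (λ i j → mulᶜ (f ↾ i) (g ↾ j) α)))

mulᶜ-scaleʳ : ∀ c f g → mulᶜ f (c ⊙ g) ≗ c ⊙ mulᶜ f g
mulᶜ-scaleʳ c f g α = trans (mulᶜ-comm f (c ⊙ g) α)
  (trans (mulᶜ-scaleˡ c g f α) (cong (c ·_) (mulᶜ-comm g f α)))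

mulᶜ-zeroˡ : ∀ g → mulᶜ 0ᶜ g ≗ 0ᶜ
mulᶜ-zeroˡ g α = trans (mulᶜ-comm 0ᶜ g α) (mulᶜ-zeroʳ g (λ _ → refl) α)

mulᶜ-sumˡ : ∀ n (F : Fin n → Coefficients) g α →
            mulᶜ (λ β → ∑[ i < n ] F i β) g α ≡ ∑[ i < n ] mulᶜ (F i) g α
mulᶜ-sumˡ zero    F g α = mulᶜ-zeroˡ g α
mulᶜ-sumˡ (suc n) F g α = trans
  (mulᶜ-distribʳ g (F zero) (λ β → ∑[ i < n ] F (suc i) β) α)
  (cong (mulᶜ (F zero) g α +_) (mulᶜ-sumˡ n (F ∘ suc) g α))

mulᶜ-sumʳ : ∀ n f (G : Fin n → Coefficients) α →
            mulᶜ f (λ β → ∑[ i < n ] G i β) α ≡ ∑[ i < n ] mulᶜ f (G i) α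
mulᶜ-sumʳ n f G α = trans (mulᶜ-comm f _ α)
  (trans (mulᶜ-sumˡ n G f α) (sum-cong-≗ {n} (λ i → mulᶜ-comm (G i) f α)))

mulᶜ-assoc : ∀ f g h → mulᶜ (mulᶜ f g) h ≗ mulᶜ f (mulᶜ g h)
mulᶜ-assoc f g h []      = ℚₚ.*-assoc (f []) (g []) (h [])
mulᶜ-assoc f g h (a ∷ α) = begin
  conv a (λ i k → mulᶜ (mulᶜ f g ↾ i) (h ↾ k) α)
    ≡⟨ conv-cong a (λ i k → mulᶜ-sumˡ (suc i) (λ j β → mulᶜ (f ↾ toℕ j) (g ↾ (i ∸ toℕ j)) β) (h ↾ k) α) ⟩
  conv a (λ i k → conv i (λ j l → mulᶜ (mulᶜ (f ↾ j) (g ↾ l)) (h ↾ k) α))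
    ≡⟨ conv-assoc a (λ j l k → mulᶜ (mulᶜ (f ↾ j) (g ↾ l)) (h ↾ k) α) ⟩
  conv a (λ j m → conv m (λ l k → mulᶜ (mulᶜ (f ↾ j) (g ↾ l)) (h ↾ k) α))
    ≡⟨ conv-cong a (λ j m → conv-cong m (λ l k → mulᶜ-assoc (f ↾ j) (g ↾ l) (h ↾ k) α)) ⟩
  conv a (λ j m → conv m (λ l k → mulᶜ (f ↾ j) (mulᶜ (g ↾ l) (h ↾ k)) α))
    ≡⟨ conv-cong a (λ j m → mulᶜ-sumʳ (suc m) (f ↾ j) (λ l β → mulᶜ (g ↾ toℕ l) (h ↾ (m ∸ toℕ l)) β) α) ⟨
  conv a (λ j m → mulᶜ (f ↾ j) (mulᶜ g h ↾ m) α) ∎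

mulᶜ-identityˡ : ∀ g → mulᶜ oneᶜ g ≗ g
mulᶜ-identityˡ g []      = ℚₚ.*-identityˡ (g [])
mulᶜ-identityˡ g (a ∷ α) = trans
  (cong₂ _+_ (mulᶜ-identityˡ (g ↾ a) α) (sum-zero a (λ i → mulᶜ-zeroˡ (g ↾ (a ∸ suc (toℕ i))) α)))
  (ℚₚ.+-identityʳ (g (a ∷ α)))

commutativeSemiring : CommutativeSemiring _ _
commutativeSemiring = record
  { Carrier = Coefficients
  ; _≈_ = _≗_
  ; _+_ = _⊕_
  ; _*_ = mulᶜ
  ; 0# = 0ᶜ
  ; 1# = oneᶜ
  ; isCommutativeSemiring = isCommutativeSemiringˡ record
    { +-isCommutativeMonoid = Pointwise.isCommutativeMonoid Monomial ℚₚ.+-0-isCommutativeMonoid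
    ; *-isCommutativeMonoid = record
      { isMonoid = record
        { isSemigroup = record
          { isMagma = record
            { isEquivalence = Pointwise.isEquivalence Monomial isEquivalence
            ; ∙-cong = λ {f} {f′} {g} {g′} f≗f′ g≗g′ α →
                trans (mulᶜ-congˡ g f≗f′ α) (mulᶜ-congʳ f′ g≗g′ α) }
          ; assoc = mulᶜ-assoc }
        ; identity = mulᶜ-identityˡ , λ f α → trans (mulᶜ-comm f oneᶜ α) (mulᶜ-identityˡ f α) }
      ; comm = mulᶜ-comm }
    ; distribʳ = mulᶜ-distribʳ
    ; zeroˡ = mulᶜ-zeroˡ
    }
  }

open Algebra.Properties.CommutativeSemigroup
  (CommutativeSemiring.*-commutativeSemigroup commutativeSemiring) using (xy∙z≈xz∙y)

_′ : PowerSeries₁ → PowerSeries₁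
(c ′) p = ι (suc p) · c (suc p)

slice : PowerSeries → ℕ → PowerSeries
slice f i = mkPS (coeff f ↾ i) (compatible f ∘ (i ∷_))

∂-cong : ∀ k {f g} → f ≈ g → ∂ k f ≈ ∂ k g
∂-cong k f≈g α = cong (ι (suc (exponent k α)) ·_) (f≈g (raise k α))

mutual
  ∂-* : ∀ k f g → coeff (∂ k (f * g)) ≗ coeff (∂ k f * g) ⊕ coeff (f * ∂ k g)
  ∂-* k f g []      = trans (sym (compatible (∂ k (f * g)) []))
    (trans (∂-*-∷ k f g 0 [])
           (cong₂ _+_ (compatible (∂ k f * g) []) (compatible (f * ∂ k g) [])))
  ∂-* k f g (a ∷ α) = ∂-*-∷ k f g a α

  ∂-*-∷ : ∀ k f g a α → coeff (∂ k (f * g)) (a ∷ α) ≡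
                        coeff (∂ k f * g) (a ∷ α) + coeff (f * ∂ k g) (a ∷ α)
  ∂-*-∷ zero    f g a α = trans
    (conv-leibniz a (λ i j → mulᶜ (coeff f ↾ i) (coeff g ↾ j) α))
    (cong₂ _+_
      (conv-cong a (λ i j → sym (mulᶜ-scaleˡ (ι (suc i)) (coeff f ↾ suc i) (coeff g ↾ j) α)))
      (conv-cong a (λ i j → sym (mulᶜ-scaleʳ (ι (suc j)) (coeff f ↾ i) (coeff g ↾ suc j) α))))
  ∂-*-∷ (suc k) f g a α = begin
    ι (suc (exponent k α)) · conv a (λ i j → mulᶜ (coeff f ↾ i) (coeff g ↾ j) (raise k α))
      ≡⟨ conv-· a (ι (suc (exponent k α))) (λ i j → mulᶜ (coeff f ↾ i) (coeff g ↾ j) (raise k α)) ⟩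
    conv a (λ i j → coeff (∂ k (slice f i * slice g j)) α)
      ≡⟨ conv-cong a (λ i j → ∂-* k (slice f i) (slice g j) α) ⟩
    conv a (λ i j → coeff (∂ k (slice f i) * slice g j) α + coeff (slice f i * ∂ k (slice g j)) α)
      ≡⟨ conv-+ a (λ i j → coeff (∂ k (slice f i) * slice g j) α)
                  (λ i j → coeff (slice f i * ∂ k (slice g j)) α) ⟩
    coeff (∂ (suc k) f * g) (a ∷ α) + coeff (f * ∂ (suc k) g) (a ∷ α) ∎

oneᶜ-raise : ∀ k α → oneᶜ (raise k α) ≡ 0ℚ
oneᶜ-raise zero    []          = refl
oneᶜ-raise zero    (_ ∷ α)     = refl
oneᶜ-raise (suc k) []          = oneᶜ-raise k []
oneᶜ-raise (suc k) (zero ∷ α)  = oneᶜ-raise k α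
oneᶜ-raise (suc k) (suc _ ∷ α) = refl

varᶜ-raise-≢ : ∀ {j k} α → k ≢ j → varᶜ k (raise j α) ≡ 0ℚ
varᶜ-raise-≢ {zero}  {zero}  α                 0≢0 = contradiction refl 0≢0
varᶜ-raise-≢ {zero}  {suc k} []                _   = refl
varᶜ-raise-≢ {zero}  {suc k} (_ ∷ α)           _   = refl
varᶜ-raise-≢ {suc j} {zero}  []                _   = refl
varᶜ-raise-≢ {suc j} {zero}  (zero ∷ α)        _   = refl
varᶜ-raise-≢ {suc j} {zero}  (suc zero ∷ α)    _   = oneᶜ-raise j α
varᶜ-raise-≢ {suc j} {zero}  (suc (suc _) ∷ α) _   = refl
varᶜ-raise-≢ {suc j} {suc k} []                k≢j = varᶜ-raise-≢ [] (k≢j ∘ cong suc)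
varᶜ-raise-≢ {suc j} {suc k} (zero ∷ α)        k≢j = varᶜ-raise-≢ α (k≢j ∘ cong suc)
varᶜ-raise-≢ {suc j} {suc k} (suc _ ∷ α)       _   = refl

∂-1# : ∀ k → coeff (∂ k 1#) ≗ 0ᶜ
∂-1# k α = trans (cong (ι (suc (exponent k α)) ·_) (oneᶜ-raise k α)) (ℚₚ.*-zeroʳ (ι (suc (exponent k α))))

∂-X : ∀ k → coeff (∂ k (X k)) ≗ oneᶜ
∂-X zero    []          = refl
∂-X zero    (zero ∷ α)  = ℚₚ.*-identityˡ (oneᶜ α)
∂-X zero    (suc a ∷ α) = ℚₚ.*-zeroʳ (ι (suc (suc a)))
∂-X (suc k) []          = ∂-X k []
∂-X (suc k) (zero ∷ α)  = ∂-X k α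
∂-X (suc k) (suc a ∷ α) = ℚₚ.*-zeroʳ (ι (suc (exponent k α)))

∂-X-≢ : ∀ {j k} → k ≢ j → coeff (∂ j (X k)) ≗ 0ᶜ
∂-X-≢ {j} k≢j α = trans (cong (ι (suc (exponent j α)) ·_) (varᶜ-raise-≢ α k≢j))
                        (ℚₚ.*-zeroʳ (ι (suc (exponent j α))))

∂-^ : ∀ k R p → coeff (∂ k (R ^ suc p)) ≗ ι (suc p) ⊙ coeff (R ^ p * ∂ k R)
∂-^ k R zero    α = begin
  coeff (∂ k (R * 1#)) α
    ≡⟨ ∂-* k R 1# α ⟩
  coeff (∂ k R * 1#) α + coeff (R * ∂ k 1#) α
    ≡⟨ cong₂ _+_ (mulᶜ-comm (coeff (∂ k R)) oneᶜ α) (mulᶜ-zeroʳ (coeff R) (∂-1# k) α) ⟩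
  coeff (1# * ∂ k R) α + 0ℚ
    ≡⟨ ℚₚ.+-identityʳ (coeff (1# * ∂ k R) α) ⟩
  coeff (1# * ∂ k R) α
    ≡⟨ ℚₚ.*-identityˡ (coeff (1# * ∂ k R) α) ⟨
  ι 1 · coeff (1# * ∂ k R) α ∎
∂-^ k R (suc p) α = begin
  coeff (∂ k (R * R ^ suc p)) α
    ≡⟨ ∂-* k R (R ^ suc p) α ⟩
  coeff (∂ k R * R ^ suc p) α + coeff (R * ∂ k (R ^ suc p)) α
    ≡⟨ cong₂ _+_ (mulᶜ-comm (coeff (∂ k R)) (coeff (R ^ suc p)) α)
                 (mulᶜ-congʳ (coeff R) (∂-^ k R p) α) ⟩
  x + mulᶜ (coeff R) (ι (suc p) ⊙ coeff (R ^ p * ∂ k R)) α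
    ≡⟨ cong (x +_) (mulᶜ-scaleʳ (ι (suc p)) (coeff R) (coeff (R ^ p * ∂ k R)) α) ⟩
  x + ι (suc p) · coeff (R * (R ^ p * ∂ k R)) α
    ≡⟨ cong₂ _+_ (ℚₚ.*-identityˡ x)
                 (cong (ι (suc p) ·_) (mulᶜ-assoc (coeff R) (coeff (R ^ p)) (coeff (∂ k R)) α)) ⟨
  ι 1 · x + ι (suc p) · x
    ≡⟨ ℚₚ.*-distribʳ-+ x (ι 1) (ι (suc p)) ⟨
  (ι 1 + ι (suc p)) · x
    ≡⟨ cong (_· x) (ι-+ 1 (suc p)) ⟨
  ι (suc (suc p)) · x ∎
  where x = coeff (R ^ suc p * ∂ k R) α

degree-raise : ∀ k α → degree (raise k α) ≡ suc (degree α)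
degree-raise zero    []      = refl
degree-raise zero    (a ∷ α) = refl
degree-raise (suc k) []      = degree-raise k []
degree-raise (suc k) (a ∷ α) = trans (cong (a ℕ.+_) (degree-raise k α)) (ℕₚ.+-suc a (degree α))

length-raise : ∀ k α → length α ≤ length (raise k α)
length-raise k       []      = z≤n
length-raise zero    (a ∷ α) = ℕₚ.≤-refl
length-raise (suc k) (a ∷ α) = s≤s (length-raise k α)

raise-length : ∀ k α → k < length (raise k α)
raise-length zero    []      = s≤s z≤n
raise-length zero    (a ∷ α) = s≤s z≤n
raise-length (suc k) []      = s≤s (raise-length k [])
raise-length (suc k) (a ∷ α) = s≤s (raise-length k α)

degree-mono : ∀ {β α} → ListPointwise _≤_ β α → degree β ≤ degree α
degree-mono []ᵖ           = z≤n
degree-mono (b≤a ∷ᵖ β≤α) = ℕₚ.+-mono-≤ b≤a (degree-mono β≤α)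

⟪⟫-* : ∀ c R g → constantTerm R ≡ 0ℚ → ∀ α →
       coeff (c ⟪ R ⟫ * g) α ≡ ∑[ p ≤ degree α ] (c (toℕ p) · coeff (R ^ toℕ p * g) α)
⟪⟫-* c R g R₀≡0 α = begin
  mulᶜ (coeff (c ⟪ R ⟫)) (coeff g) α
    ≡⟨ mulᶜ-congˡ-≤ (coeff g) α (λ {β} β≤α → sym (sum-truncate
         (λ p → c p · coeff (R ^ p) β) (s≤s (degree-mono β≤α))
         (λ p d<p → trans (cong (c p ·_) (^-vanishes R R₀≡0 p β d<p)) (ℚₚ.*-zeroʳ (c p))))) ⟩
  mulᶜ (λ β → ∑[ p ≤ degree α ] (c (toℕ p) · coeff (R ^ toℕ p) β)) (coeff g) α
    ≡⟨ mulᶜ-sumˡ (suc (degree α)) (λ p → c (toℕ p) ⊙ coeff (R ^ toℕ p)) (coeff g) α ⟩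
  ∑[ p ≤ degree α ] mulᶜ (c (toℕ p) ⊙ coeff (R ^ toℕ p)) (coeff g) α
    ≡⟨ sum-cong-≗ {suc (degree α)} (λ p → mulᶜ-scaleˡ (c (toℕ p)) (coeff (R ^ toℕ p)) (coeff g) α) ⟩
  ∑[ p ≤ degree α ] (c (toℕ p) · coeff (R ^ toℕ p * g) α) ∎

∂-⟪⟫ : ∀ k c R → constantTerm R ≡ 0ℚ → ∂ k (c ⟪ R ⟫) ≈ (c ′) ⟪ R ⟫ * ∂ k R
∂-⟪⟫ k c R R₀≡0 α = begin
  e · ∑[ p ≤ degree (raise k α) ] (c (toℕ p) · coeff (R ^ toℕ p) (raise k α))
    ≡⟨ cong (λ d → e · (∑[ p ≤ d ] (c (toℕ p) · coeff (R ^ toℕ p) (raise k α)))) (degree-raise k α) ⟩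
  e · ∑[ p ≤ suc (degree α) ] (c (toℕ p) · coeff (R ^ toℕ p) (raise k α))
    ≡⟨ *-distribˡ-sum {suc (suc (degree α))} e (λ p → c (toℕ p) · coeff (R ^ toℕ p) (raise k α)) ⟩
  ∑[ p ≤ suc (degree α) ] (e · (c (toℕ p) · coeff (R ^ toℕ p) (raise k α)))
    ≡⟨ sum-cong-≗ {suc (suc (degree α))} (λ p → ℚ*.x∙yz≈y∙xz e (c (toℕ p)) (coeff (R ^ toℕ p) (raise k α))) ⟩
  c 0 · coeff (∂ k 1#) α + rest
    ≡⟨ cong (_+ rest) (trans (cong (c 0 ·_) (∂-1# k α)) (ℚₚ.*-zeroʳ (c 0))) ⟩
  0ℚ + rest
    ≡⟨ ℚₚ.+-identityˡ rest ⟩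
  rest
    ≡⟨ sum-cong-≗ {suc (degree α)} (λ p → term (toℕ p)) ⟩
  ∑[ p ≤ degree α ] ((c ′) (toℕ p) · coeff (R ^ toℕ p * ∂ k R) α)
    ≡⟨ ⟪⟫-* (c ′) R (∂ k R) R₀≡0 α ⟨
  coeff ((c ′) ⟪ R ⟫ * ∂ k R) α ∎
  where
  e = ι (suc (exponent k α))
  rest = ∑[ p ≤ degree α ] (c (suc (toℕ p)) · coeff (∂ k (R ^ suc (toℕ p))) α)

  term : ∀ p → c (suc p) · coeff (∂ k (R ^ suc p)) α ≡ (c ′) p · coeff (R ^ p * ∂ k R) α
  term p = trans (cong (c (suc p) ·_) (∂-^ k R p α))
                 (ℚ*.x∙yz≈yx∙z (c (suc p)) (ι (suc p)) (coeff (R ^ p * ∂ k R) α))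

∑X-cong : ∀ {F G} → (∀ k → F k ≈ G k) → ∑X F ≈ ∑X G
∑X-cong F≈G α = sum-cong-≗ {length α} (λ k → mulᶜ-congˡ (varᶜ (toℕ k)) (F≈G (toℕ k)) α)

∑X-* : ∀ F g → ∑X F * g ≈ ∑X (λ k → F k * g)
∑X-* F g α = begin
  mulᶜ (coeff (∑X F)) (coeff g) α
    ≡⟨ mulᶜ-congˡ-≤ (coeff g) α (λ {β} β≤α →
         cong (λ n → ∑[ k < n ] coeff (F (toℕ k) * X (toℕ k)) β) (Pointwise-length β≤α)) ⟩
  mulᶜ (λ β → ∑[ k < length α ] coeff (F (toℕ k) * X (toℕ k)) β) (coeff g) α
    ≡⟨ mulᶜ-sumˡ (length α) (λ k → coeff (F (toℕ k) * X (toℕ k))) (coeff g) α ⟩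
  ∑[ k < length α ] coeff (F (toℕ k) * X (toℕ k) * g) α
    ≡⟨ sum-cong-≗ {length α} (λ k → xy∙z≈xz∙y (coeff (F (toℕ k))) (varᶜ (toℕ k)) (coeff g) α) ⟩
  ∑[ k < length α ] coeff (F (toℕ k) * g * X (toℕ k)) α ∎

∂-∑X : ∀ j F → coeff (∂ j (∑X F)) ≗ coeff (∑X (∂ j ∘ F)) ⊕ coeff (F j)
∂-∑X j F α = begin
  e · ∑[ k < n ] coeff (F (toℕ k) * X (toℕ k)) (raise j α)
    ≡⟨ *-distribˡ-sum {n} e (λ k → coeff (F (toℕ k) * X (toℕ k)) (raise j α)) ⟩
  ∑[ k < n ] coeff (∂ j (F (toℕ k) * X (toℕ k))) α
    ≡⟨ sum-cong-≗ {n} (λ k → ∂-* j (F (toℕ k)) (X (toℕ k)) α) ⟩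
  ∑[ k < n ] (u (toℕ k) + v (toℕ k))
    ≡⟨ ∑-distrib-+ {n} (u ∘ toℕ) (v ∘ toℕ) ⟩
  ∑[ k < n ] u (toℕ k) + ∑[ k < n ] v (toℕ k)
    ≡⟨ cong₂ _+_
         (sum-truncate u (length-raise j α) (λ k → mulᶜ-varᶜ-zero (coeff (∂ j (F k))) k α))
         (sum-single j v (raise-length j α) (λ k k≢j → mulᶜ-zeroʳ (coeff (F k)) (∂-X-≢ k≢j) α)) ⟩
  coeff (∑X (∂ j ∘ F)) α + mulᶜ (coeff (F j)) (coeff (∂ j (X j))) α
    ≡⟨ cong (coeff (∑X (∂ j ∘ F)) α +_)
            (trans (mulᶜ-congʳ (coeff (F j)) (∂-X j) α)
                   (CommutativeSemiring.*-identityʳ commutativeSemiring (coeff (F j)) α)) ⟩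
  coeff (∑X (∂ j ∘ F)) α + coeff (F j) α ∎
  where
  e = ι (suc (exponent j α))
  n = length (raise j α)

  u v : ℕ → ℚ
  u k = coeff (∂ j (F k) * X k) α
  v k = coeff (F k * ∂ j (X k)) α

I-diagonal : ∀ b p → I b b (suc p) ≡ 0ℚ
I-diagonal b p = trans
  (cong (λ z → (z ℤ.* (∏[ m < p ] ((ℤ.+ b) ℤ.^ 2 ℤ.- (ℤ.+ b ℤ.- ℤ.+ suc (toℕ m)) ℤ.^ 2))) / (suc p ℕ.!) ℕ.^ 2)
        (trans (cong (λ z → (ℤ.+ b) ℤ.^ 2 ℤ.- z ℤ.^ 2) (ℤₚ.+-identityʳ (ℤ.+ b)))
               (ℤₚ.+-inverseʳ ((ℤ.+ b) ℤ.^ 2))))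
  (ℚₚ.0/n≡0 ((suc p ℕ.!) ℕ.^ 2))
  where instance _ = ℕₚ.m^n≢0 (suc p ℕ.!) 2 {{suc p ℕₚ.!≢0}}

I-diagonal-⟪⟫ : ∀ b R → I b b ⟪ R ⟫ ≈ 1#
I-diagonal-⟪⟫ b R α = trans
  (cong₂ _+_ (ℚₚ.*-identityˡ (oneᶜ α))
             (sum-zero (degree α) (λ p → trans
               (cong (_· coeff (R ^ suc (toℕ p)) α) (I-diagonal b (toℕ p)))
               (ℚₚ.*-zeroˡ (coeff (R ^ suc (toℕ p)) α)))))
  (ℚₚ.+-identityʳ (oneᶜ α))

lemma12 : (b ℓ : ℕ) → b ≤ ℓ → (R̂ : PowerSeries) → IsR̂ b R̂ →
          ∂/∂x̂ b ℓ R̂ ≈ I b ℓ ⟪ R̂ ⟫ * ∂/∂x̂ b b R̂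
lemma12 b ℓ b≤ℓ R̂ isR̂ =
  subst₂ (λ ℓ′ i → ∂/∂x̂ b ℓ R̂ ≈ I b ℓ′ ⟪ R̂ ⟫ * ∂ i R̂)
         (ℕₚ.m+[n∸m]≡n b≤ℓ) (sym (ℕₚ.n∸n≡0 b)) (∂-proportional (ℓ ∸ b))
  where
  open IsR̂ isR̂

  Iᴿ : ℕ → PowerSeries
  Iᴿ k = I b (b ℕ.+ k) ⟪ R̂ ⟫

  A B : PowerSeries
  A = (J b ′) ⟪ R̂ ⟫
  B = ∑X (λ k → (I b (b ℕ.+ k) ′) ⟪ R̂ ⟫)

  J≈∑I : J b ⟪ R̂ ⟫ ≈ ∑X Iᴿ
  J≈∑I α = x∙y⁻¹≈ε⇒x≈y (coeff (J b ⟪ R̂ ⟫) α) (coeff (∑X Iᴿ) α) (equation α)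

  differentiated : ∀ k → coeff (A * ∂ k R̂) ≗ coeff (B * ∂ k R̂) ⊕ coeff (Iᴿ k)
  differentiated k α = begin
    coeff (A * ∂ k R̂) α
      ≡⟨ ∂-⟪⟫ k (J b) R̂ zeroConstantTerm α ⟨
    coeff (∂ k (J b ⟪ R̂ ⟫)) α
      ≡⟨ ∂-cong k {J b ⟪ R̂ ⟫} {∑X Iᴿ} J≈∑I α ⟩
    coeff (∂ k (∑X Iᴿ)) α
      ≡⟨ ∂-∑X k Iᴿ α ⟩
    coeff (∑X (∂ k ∘ Iᴿ)) α + coeff (Iᴿ k) α
      ≡⟨ cong (_+ coeff (Iᴿ k) α) (trans
           (∑X-cong {∂ k ∘ Iᴿ} {λ m → (I b (b ℕ.+ m) ′) ⟪ R̂ ⟫ * ∂ k R̂}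
             (λ m → ∂-⟪⟫ k (I b (b ℕ.+ m)) R̂ zeroConstantTerm) α)
           (sym (∑X-* (λ m → (I b (b ℕ.+ m) ′) ⟪ R̂ ⟫) (∂ k R̂) α))) ⟩
    coeff (B * ∂ k R̂) α + coeff (Iᴿ k) α ∎

  Iᴿ₀≈1 : Iᴿ 0 ≈ 1#
  Iᴿ₀≈1 = subst (λ ℓ′ → I b ℓ′ ⟪ R̂ ⟫ ≈ 1#) (sym (ℕₚ.+-identityʳ b)) (I-diagonal-⟪⟫ b R̂)

  -- Both sides become equal to A · ∂ₖ R̂ · ∂₀ R̂ after adding B · ∂ₖ R̂ · ∂₀ R̂.
  ∂-proportional : ∀ k → ∂ k R̂ ≈ Iᴿ k * ∂ 0 R̂
  ∂-proportional k α = ∙-cancelˡ (coeff (B * ∂ k R̂ * ∂ 0 R̂) α) _ _ (begin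
    coeff (B * ∂ k R̂ * ∂ 0 R̂) α + coeff (∂ k R̂) α
      ≡⟨ cong₂ _+_ (xy∙z≈xz∙y (coeff B) (coeff (∂ k R̂)) (coeff (∂ 0 R̂)) α)
                   (sym (mulᶜ-identityˡ (coeff (∂ k R̂)) α)) ⟩
    coeff (B * ∂ 0 R̂ * ∂ k R̂) α + coeff (1# * ∂ k R̂) α
      ≡⟨ mulᶜ-distribʳ (coeff (∂ k R̂)) (coeff (B * ∂ 0 R̂)) oneᶜ α ⟨
    mulᶜ (coeff (B * ∂ 0 R̂) ⊕ oneᶜ) (coeff (∂ k R̂)) α
      ≡⟨ mulᶜ-congˡ (coeff (∂ k R̂)) (λ β →
           trans (differentiated 0 β) (cong (coeff (B * ∂ 0 R̂) β +_) (Iᴿ₀≈1 β))) α ⟨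
    coeff (A * ∂ 0 R̂ * ∂ k R̂) α
      ≡⟨ xy∙z≈xz∙y (coeff A) (coeff (∂ 0 R̂)) (coeff (∂ k R̂)) α ⟩
    coeff (A * ∂ k R̂ * ∂ 0 R̂) α
      ≡⟨ mulᶜ-congˡ (coeff (∂ 0 R̂)) (differentiated k) α ⟩
    mulᶜ (coeff (B * ∂ k R̂) ⊕ coeff (Iᴿ k)) (coeff (∂ 0 R̂)) α
      ≡⟨ mulᶜ-distribʳ (coeff (∂ 0 R̂)) (coeff (B * ∂ k R̂)) (coeff (Iᴿ k)) α ⟩
    coeff (B * ∂ k R̂ * ∂ 0 R̂) α + coeff (Iᴿ k * ∂ 0 R̂) α ∎)
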